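{- Let $C_{(>,\neq)}(x,y)$ be the bivariate generating function of the Catalan words avoiding the ordered pair of relations $(>,\neq)$, where $x$ marks the length and $y$ marks the number of descents. Then $$C_{(>,\neq)}(x,y)=\frac{\left(1-2x - \sqrt {1 - 4 x + 4 x^2 - 4 x^3 y}\right) \left(1-x \right)}{2x^3y}.$$
   Context: A Catalan word of length $n$ is a word $w=w_1w_2\cdots w_n$ over the non-negative integers with $w_1=0$ and $0\leq w_i\leq w_{i-1}+1$ for $i=2,\dots,n$; the empty word is the unique Catalan word of length $0$. For relations $X,Y\in\{<,>,\leq,\geq,=,\neq\}$, a word $w$ contains the pattern $(X,Y)$ if there is an index $i\geq 1$ (with $i+2\le n$) such that $w_i\,X\,w_{i+1}$ and $w_{i+1}\,Y\,w_{i+2}$; otherwise $w$ avoids $(X,Y)$. The number of descents $\mathrm{des}(w)$ is the number of indices $i$ with $w_i>w_{i+1}$. The bivariate generating function is $C_{(X,Y)}(x,y)=\sum_{w}x^{|w|}y^{\mathrm{des}(w)}$, the sum being over all Catalan words $w$ (of any length $|w|\geq 0$) avoiding $(X,Y)$. Identities are between formal power series in $x$ with coefficients polynomials in $y$ (after clearing denominators); the square root of a power series with constant term $1$ is the one with constant term $1$. -}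

module Defs where

open import Algebra.Bundles.Raw using (RawRing)
import Algebra.Definitions.RawSemiring as RawSemiringDefinitions
open import Data.Bool.Base using (if_then_else_)
open import Data.Fin.Base using (toℕ)
open import Data.Integer.Base as ℤ using (+_)
open import Data.List.Base using (List; []; _∷_; [_]; length; map; concatMap; upTo; filter; foldr; head)
open import Data.List.Membership.Propositional using (_∈_; find; lose)
open import Data.List.Membership.Propositional.Properties
  using (∈-map⁺; ∈-map⁻; ∈-concatMap⁺; ∈-concatMap⁻; ∈-upTo⁺; ∈-upTo⁻)
import Data.List.Properties as List
open import Data.List.Relation.Binary.Disjoint.Propositional using (Disjoint)
open import Data.List.Relation.Unary.All using (All; []; _∷_)
import Data.List.Relation.Unary.All as All
import Data.List.Relation.Unary.All.Properties as All
open import Data.List.Relation.Unary.AllPairs using ([]; _∷_)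
import Data.List.Relation.Unary.AllPairs as AllPairs
import Data.List.Relation.Unary.AllPairs.Properties as AllPairs
open import Data.List.Relation.Unary.Any using (here; there)
open import Data.List.Relation.Unary.Linked using (Linked; []; [-]; _∷_)
open import Data.List.Relation.Unary.Unique.Propositional using (Unique)
import Data.List.Relation.Unary.Unique.Propositional.Properties as Unique
import Data.Maybe.Relation.Unary.All as Maybe
open import Data.Nat.Base as ℕ using (ℕ; zero; suc; _≤_; _∸_; _>_; s≤s)
open import Data.Nat.Properties using (_>?_; _≟_; suc-injective)
open import Data.Product.Base using (_×_; _,_)
open import Function.Base using (_∘_)
open import Function.Bundles using (_⇔_; mk⇔)
open import Level using (0ℓ)
open import Relation.Binary.Core using (Rel)
open import Relation.Binary.Definitions using (Decidable)
open import Relation.Binary.PropositionalEquality using (_≡_; _≢_; refl; cong)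
open import Relation.Nullary using (Dec; does; yes; no; ¬_)
open import Relation.Nullary.Decidable using (¬?; _×-dec_)

------------------------------------------------------------------------
-- Catalan words

Word : Set
Word = List ℕ

Catalan : Word → Set
Catalan w = Maybe.All (_≡ 0) (head w) × Linked (λ a b → b ≤ suc a) w

des : Word → ℕ
des []              = 0
des (_ ∷ [])        = 0
des (a ∷ w@(b ∷ _)) = (if does (a >? b) then 1 else 0) ℕ.+ des w

data Contains (X Y : Rel ℕ 0ℓ) : Word → Set where
  here  : ∀ {a b c w} → X a b → Y b c → Contains X Y (a ∷ b ∷ c ∷ w)
  there : ∀ {a w} → Contains X Y w → Contains X Y (a ∷ w)

Avoids : (X Y : Rel ℕ 0ℓ) → Word → Set
Avoids X Y w = ¬ Contains X Y w

contains? : ∀ {X Y} → Decidable X → Decidable Y → ∀ w → Dec (Contains X Y w)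
contains? X? Y? []       = no λ ()
contains? X? Y? (a ∷ []) = no λ { (there ()) }
contains? X? Y? (a ∷ b ∷ []) = no λ { (there (there ())) }
contains? X? Y? (a ∷ b ∷ c ∷ w)
  with X? a b ×-dec Y? b c | contains? X? Y? (b ∷ c ∷ w)
... | yes (p , q) | _     = yes (here p q)
... | no _        | yes r = yes (there r)
... | no ¬pq      | no ¬r = no λ { (here p q) → ¬pq (p , q) ; (there r) → ¬r r }

avoids? : ∀ {X Y} → Decidable X → Decidable Y → ∀ w → Dec (Avoids X Y w)
avoids? X? Y? w = ¬? (contains? X? Y? w)

_≢?_ : Decidable (_≢_ {A = ℕ})
a ≢? b = ¬? (a ≟ b)

-- The words u of length n that may follow a letter a in a Catalan word.
continuations : ℕ → ℕ → List Word
continuations a zero    = [ [] ]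
continuations a (suc n) =
  concatMap (λ b → map (b ∷_) (continuations b n)) (upTo (suc (suc a)))

catalanWords : ℕ → List Word
catalanWords zero    = [ [] ]
catalanWords (suc n) = map (0 ∷_) (continuations 0 n)

-- catalanWords n lists every Catalan word of length n exactly once
-- (∈-catalanWords and catalanWords-unique).

∈-continuations : ∀ a n u →
  u ∈ continuations a n ⇔ (length u ≡ n × Linked (λ a b → b ≤ suc a) (a ∷ u))
∈-continuations a n u = mk⇔ (to a n u) (from a n u)
  where
  to : ∀ a n u → u ∈ continuations a n →
       length u ≡ n × Linked (λ a b → b ≤ suc a) (a ∷ u)
  to a zero    _ (here refl) = refl , [-]
  to a (suc n) u u∈ with find (∈-concatMap⁻ (λ b → map (b ∷_) (continuations b n)) {xs = upTo (suc (suc a))} u∈)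
  ... | b , b∈ , u∈map with ∈-map⁻ (b ∷_) u∈map | ∈-upTo⁻ b∈
  ... | v , v∈ , refl | s≤s b≤1+a with to b n v v∈
  ... | refl , linked = refl , b≤1+a ∷ linked

  from : ∀ a n u → length u ≡ n × Linked (λ a b → b ≤ suc a) (a ∷ u) →
         u ∈ continuations a n
  from a zero    []      _ = here refl
  from a (suc n) (b ∷ u) (eq , b≤1+a ∷ linked) =
    ∈-concatMap⁺ (λ b → map (b ∷_) (continuations b n)) (lose (∈-upTo⁺ (s≤s b≤1+a))
      (∈-map⁺ (b ∷_) (from b n u (suc-injective eq , linked))))

∈-catalanWords : ∀ n w → w ∈ catalanWords n ⇔ (length w ≡ n × Catalan w)
∈-catalanWords n w = mk⇔ (to n w) (from n w)
  where
  open import Function.Bundles using (module Equivalence)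

  to : ∀ n w → w ∈ catalanWords n → length w ≡ n × Catalan w
  to zero    _ (here refl) = refl , Maybe.nothing , []
  to (suc n) w w∈ with ∈-map⁻ (0 ∷_) w∈
  ... | u , u∈ , refl with Equivalence.to (∈-continuations 0 n u) u∈
  ... | refl , linked = refl , Maybe.just refl , linked

  from : ∀ n w → length w ≡ n × Catalan w → w ∈ catalanWords n
  from zero    []      _ = here refl
  from (suc n) (_ ∷ u) (eq , Maybe.just refl , linked) =
    ∈-map⁺ (0 ∷_) (Equivalence.from (∈-continuations 0 n u) (suc-injective eq , linked))

continuations-unique : ∀ a n → Unique (continuations a n)
continuations-unique a zero    = [] ∷ []
continuations-unique a (suc n) = Unique.concat⁺
  (All.map⁺ (All.universal
    (λ b → Unique.map⁺ List.∷-injectiveʳ (continuations-unique b n)) _))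
  (AllPairs.map⁺ (AllPairs.map disjoint (Unique.upTo⁺ (suc (suc a)))))
  where
  disjoint : ∀ {b c} → b ≢ c →
    Disjoint (map (b ∷_) (continuations b n)) (map (c ∷_) (continuations c n))
  disjoint {b} {c} b≢c (v∈b , v∈c) with ∈-map⁻ (b ∷_) v∈b | ∈-map⁻ (c ∷_) v∈c
  ... | _ , _ , refl | _ , _ , eq = b≢c (List.∷-injectiveˡ eq)

catalanWords-unique : ∀ n → Unique (catalanWords n)
catalanWords-unique zero    = [] ∷ []
catalanWords-unique (suc n) =
  Unique.map⁺ List.∷-injectiveʳ (continuations-unique 0 n)

------------------------------------------------------------------------
-- Polynomials: coefficient lists, constant term first, compared
-- coefficientwise so that trailing zeros are immaterial.

module _ {c ℓ} (R : RawRing c ℓ) where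
  open RawRing R

  coeff : List Carrier → ℕ → Carrier
  coeff []      _       = 0#
  coeff (a ∷ _) zero    = a
  coeff (_ ∷ p) (suc k) = coeff p k

  addₚ : List Carrier → List Carrier → List Carrier
  addₚ []      q       = q
  addₚ p       []      = p
  addₚ (a ∷ p) (b ∷ q) = a + b ∷ addₚ p q

  mulₚ : List Carrier → List Carrier → List Carrier
  mulₚ []      q = []
  mulₚ (a ∷ p) q = addₚ (map (a *_) q) (0# ∷ mulₚ p q)

  Polynomial : RawRing c ℓ
  Polynomial = record
    { Carrier = List Carrier
    ; _≈_     = λ p q → ∀ k → coeff p k ≈ coeff q k
    ; _+_     = addₚ
    ; _*_     = mulₚ
    ; -_      = map -_
    ; 0#      = []
    ; 1#      = [ 1# ]
    }

------------------------------------------------------------------------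
-- Formal power series: f n is the coefficient of the n-th power.

module _ {c ℓ} (R : RawRing c ℓ) where
  open RawRing R
  open RawSemiringDefinitions rawSemiring using (sum)

  constant : Carrier → ℕ → Carrier
  constant a zero    = a
  constant a (suc _) = 0#

  PowerSeries : RawRing c ℓ
  PowerSeries = record
    { Carrier = ℕ → Carrier
    ; _≈_     = λ f g → ∀ n → f n ≈ g n
    ; _+_     = λ f g n → f n + g n
    ; _*_     = λ f g n → sum {suc n} (λ i → f (toℕ i) * g (n ∸ toℕ i))
    ; -_      = λ f n → - f n
    ; 0#      = λ _ → 0#
    ; 1#      = constant 1#
    }

------------------------------------------------------------------------
-- The ring ℤ[y]⟦x⟧

ℤ[y] : RawRing 0ℓ 0ℓ
ℤ[y] = Polynomial ℤ.+-*-rawRing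

ℤ[y]⟦x⟧ : RawRing 0ℓ 0ℓ
ℤ[y]⟦x⟧ = PowerSeries ℤ[y]

module ℤ[y] where
  open RawRing ℤ[y] public
  open RawSemiringDefinitions rawSemiring public using (_^_)

  y : Carrier
  y = + 0 ∷ + 1 ∷ []

module ℤ[y]⟦x⟧ where
  open RawRing ℤ[y]⟦x⟧ public
  open RawSemiringDefinitions rawSemiring public using (_^_)

  infixl 6 _-_
  _-_ : Carrier → Carrier → Carrier
  f - g = f + - g

  # : ℕ → Carrier
  # m = constant ℤ[y] [ + m ]

  x y : Carrier
  x 1 = ℤ[y].1#
  x _ = ℤ[y].0#
  y = constant ℤ[y] ℤ[y].y

  IsSqrt : Carrier → Carrier → Set
  IsSqrt f s = s 0 ℤ[y].≈ ℤ[y].1# × s * s ≈ f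

  -- s is the unique power series with constant term 1 and square f.
  IsTheSqrt : Carrier → Carrier → Set
  IsTheSqrt f s = IsSqrt f s × (∀ t → IsSqrt f t → t ≈ s)

-- The generating function of the Catalan words avoiding (X,Y): its
-- coefficient at xⁿ is the sum of y^(des w) over such words w of length n.
C : ∀ {X Y : Rel ℕ 0ℓ} → Decidable X → Decidable Y → ℤ[y]⟦x⟧.Carrier
C X? Y? n =
  foldr _+_ 0# (map (λ w → y ^ des w) (filter (avoids? X? Y?) (catalanWords n)))
  where open ℤ[y]

{-# OPTIONS --safe #-}
module Submission where

open import Defs
open import Data.Nat.Properties using (_>?_)
open import Data.Product using (∃; _×_)
open import Algebra.Bundles using (CommutativeRing; Semiring)
open import Algebra.Bundles.Raw using (RawRing)
import Algebra.Construct.Pointwise as Pointwise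
import Algebra.Definitions.RawSemiring as RawSemiringDefinitions
open import Algebra.Morphism.Structures using (IsRingMonomorphism)
import Algebra.Morphism.RingMonomorphism as RingMonomorphism
import Algebra.Properties.Ring as RingProperties
import Algebra.Properties.Semiring.Sum as Sum
import Algebra.Solver.Ring as RingSolver
open import Algebra.Solver.Ring.AlmostCommutativeRing
  using (fromCommutativeRing; _-Raw-AlmostCommutative⟶_)
open import Data.Bool.Base using (true; false; if_then_else_)
open import Data.Fin.Base using (toℕ)
import Data.Fin.Properties as Fin
open import Data.Integer.Base as ℤ using (+_)
import Data.Integer.Properties as ℤ
open import Data.List.Base using (List; []; _∷_; [_]; _++_; _∷ʳ_; map; concatMap; upTo; filter; foldr)
import Data.List.Properties as List
open import Data.Maybe.Base as Maybe using (Maybe)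
open import Data.Nat.Base as ℕ using (ℕ; zero; suc; _∸_; _<_; _>_; z≤n; s≤s)
import Data.Nat.Properties as ℕ
open import Data.Product using (_,_)
open import Data.Sum.Base using (inj₁; inj₂)
open import Function.Base using (_∘_; id)
open import Function.Bundles using (_⇔_; mk⇔)
open import Relation.Binary.PropositionalEquality as ≡ using (_≡_; _≢_)
import Relation.Binary.Reasoning.Setoid as SetoidReasoning
open import Relation.Nullary using (does; ¬_)
open import Relation.Nullary.Decidable using (dec⇒maybe; dec-true; dec-false; does-⇔)
open import Relation.Unary using (Pred)
import Relation.Unary as Unary

-- Let F a be the generating function of the words that may follow a letter a
-- and G a that of the words that may follow a letter a just reached by a
-- descent; such a word is empty or starts with a again, so G a = 1 + x F a.
-- Splitting F a by the next letter gives
--   F a = 1 + x (F a + F (a + 1) + y Σ_{b<a} G b),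
-- and these equations determine all coefficients. Eliminating F and solving the
-- resulting linear recurrence in a yields G a = (1 - x) D (1 + x² y D)ᵃ, where D
-- is the power series with D = 1 + 2 x D + x³ y D². Hence C = G 0 = (1 - x) D,
-- and completing the square shows that the root is 1 - 2 x - 2 x³ y D.

-- Power series over a commutative ring

module PowerSeriesProperties {c ℓ} (R : CommutativeRing c ℓ) where
  open CommutativeRing R
  open RawRing (PowerSeries rawRing) public
    using () renaming (Carrier to Series; _≈_ to _≈ₛ_; _+_ to _+ₛ_; _*_ to _*ₛ_; -_ to -ₛ_; 0# to 0ₛ; 1# to 1ₛ)
  open Sum semiring using (sum-cong-≋; ∑-distrib-+; *-distribˡ-sum)
  open SetoidReasoning setoid

  tail : Series → Series
  tail f = f ∘ suc

  -- The convolution sum unfolds at its first term; splitting off the last term instead is what lets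
  -- commutativity go through by induction.
  *-suc : ∀ f g n → (f *ₛ g) (suc n) ≈ (f *ₛ tail g) n + f (suc n) * g 0
  *-suc f g zero = begin
    f 0 * g 1 + (f 1 * g 0 + 0#)  ≈⟨ +-congˡ (+-identityʳ _) ⟩
    f 0 * g 1 + f 1 * g 0         ≈⟨ +-congʳ (+-identityʳ _) ⟨
    f 0 * g 1 + 0# + f 1 * g 0    ∎
  *-suc f g (suc n) = begin
    f 0 * g (suc (suc n)) + (tail f *ₛ g) (suc n)
      ≈⟨ +-congˡ (*-suc (tail f) g n) ⟩
    f 0 * g (suc (suc n)) + ((tail f *ₛ tail g) n + f (suc (suc n)) * g 0)
      ≈⟨ +-assoc _ _ _ ⟨
    f 0 * g (suc (suc n)) + (tail f *ₛ tail g) n + f (suc (suc n)) * g 0 ∎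

  *ₛ-comm : ∀ f g → f *ₛ g ≈ₛ g *ₛ f
  *ₛ-comm f g zero    = +-congʳ (*-comm _ _)
  *ₛ-comm f g (suc n) = begin
    (f *ₛ g) (suc n)                      ≈⟨ *-suc f g n ⟩
    (f *ₛ tail g) n + f (suc n) * g 0     ≈⟨ +-cong (*ₛ-comm f (tail g) n) (*-comm _ _) ⟩
    (tail g *ₛ f) n + g 0 * f (suc n)     ≈⟨ +-comm _ _ ⟩
    g 0 * f (suc n) + (tail g *ₛ f) n     ∎

  *ₛ-distribʳ : ∀ h f g → (f +ₛ g) *ₛ h ≈ₛ (f *ₛ h) +ₛ (g *ₛ h)
  *ₛ-distribʳ h f g n = trans
    (sum-cong-≋ {suc n} (λ i → distribʳ (h (n ∸ toℕ i)) (f (toℕ i)) (g (toℕ i))))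
    (∑-distrib-+ {suc n} (λ i → f (toℕ i) * h (n ∸ toℕ i)) (λ i → g (toℕ i) * h (n ∸ toℕ i)))

  scale-*ₛ : ∀ a f g → (λ n → a * f n) *ₛ g ≈ₛ (λ n → a * (f *ₛ g) n)
  scale-*ₛ a f g n = trans
    (sum-cong-≋ {suc n} (λ i → *-assoc a (f (toℕ i)) (g (n ∸ toℕ i))))
    (sym (*-distribˡ-sum {suc n} a (λ i → f (toℕ i) * g (n ∸ toℕ i))))

  *ₛ-zeroˡ : ∀ f → 0ₛ *ₛ f ≈ₛ 0ₛ
  *ₛ-zeroˡ f zero    = trans (+-identityʳ _) (zeroˡ _)
  *ₛ-zeroˡ f (suc n) = trans (+-cong (zeroˡ _) (*ₛ-zeroˡ f n)) (+-identityʳ _)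

  constant-*ₛ : ∀ a f → constant rawRing a *ₛ f ≈ₛ (λ n → a * f n)
  constant-*ₛ a f zero    = +-identityʳ _
  constant-*ₛ a f (suc n) = trans (+-congˡ (*ₛ-zeroˡ f n)) (+-identityʳ _)

  *ₛ-identityˡ : ∀ f → 1ₛ *ₛ f ≈ₛ f
  *ₛ-identityˡ f n = trans (constant-*ₛ 1# f n) (*-identityˡ _)

  -- Induction on the coefficient for all `f` at once: `tail (f *ₛ g)` is by definition the sum of
  -- `f 0` times `tail g` and of `tail f *ₛ g`.
  *ₛ-assoc : ∀ f g h → (f *ₛ g) *ₛ h ≈ₛ f *ₛ (g *ₛ h)
  *ₛ-assoc f g h zero = begin
    (f 0 * g 0 + 0#) * h 0 + 0#  ≈⟨ +-congʳ (*-congʳ (+-identityʳ _)) ⟩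
    f 0 * g 0 * h 0 + 0#         ≈⟨ +-congʳ (*-assoc _ _ _) ⟩
    f 0 * (g 0 * h 0) + 0#       ≈⟨ +-congʳ (*-congˡ (+-identityʳ _)) ⟨
    f 0 * (g 0 * h 0 + 0#) + 0#  ∎
  *ₛ-assoc f g h (suc n) = begin
    (f 0 * g 0 + 0#) * h (suc n) + (tail (f *ₛ g) *ₛ h) n
      ≈⟨ +-cong (trans (*-congʳ (+-identityʳ _)) (*-assoc _ _ _))
                (*ₛ-distribʳ h (λ m → f 0 * g (suc m)) (tail f *ₛ g) n) ⟩
    f 0 * (g 0 * h (suc n)) + (((λ m → f 0 * g (suc m)) *ₛ h) n + ((tail f *ₛ g) *ₛ h) n)
      ≈⟨ +-congˡ (+-cong (scale-*ₛ (f 0) (tail g) h n) (*ₛ-assoc (tail f) g h n)) ⟩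
    f 0 * (g 0 * h (suc n)) + (f 0 * (tail g *ₛ h) n + (tail f *ₛ (g *ₛ h)) n)
      ≈⟨ +-assoc _ _ _ ⟨
    f 0 * (g 0 * h (suc n)) + f 0 * (tail g *ₛ h) n + (tail f *ₛ (g *ₛ h)) n
      ≈⟨ +-congʳ (distribˡ _ _ _) ⟨
    f 0 * (g *ₛ h) (suc n) + (tail f *ₛ (g *ₛ h)) n ∎

  *ₛ-cong : ∀ {f f′ g g′} → f ≈ₛ f′ → g ≈ₛ g′ → f *ₛ g ≈ₛ f′ *ₛ g′
  *ₛ-cong f≈ g≈ n = sum-cong-≋ {suc n} (λ i → *-cong (f≈ (toℕ i)) (g≈ (n ∸ toℕ i)))

  powerSeriesRing : CommutativeRing c ℓ
  powerSeriesRing = record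
    { isCommutativeRing = record
      { isRing = record
        { +-isAbelianGroup = Pointwise.isAbelianGroup ℕ +-isAbelianGroup
        ; *-cong           = λ {f f′ g g′} → *ₛ-cong {f} {f′} {g} {g′}
        ; *-assoc          = *ₛ-assoc
        ; *-identity       = *ₛ-identityˡ
                           , λ f n → trans (*ₛ-comm f 1ₛ n) (*ₛ-identityˡ f n)
        ; distrib          = (λ h f g n → trans (*ₛ-comm h (f +ₛ g) n)
                               (trans (*ₛ-distribʳ h f g n)
                                 (+-cong (*ₛ-comm f h n) (*ₛ-comm g h n))))
                           , *ₛ-distribʳ
        }
      ; *-comm = *ₛ-comm
      }
    }

  -- Congruence modulo a power of the indeterminate

  infix 4 _≈[_]_
  _≈[_]_ : Series → ℕ → Series → Set ℓ
  f ≈[ n ] g = ∀ {i} → i < n → f i ≈ g i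

  *-cong[] : ∀ {n f f′ g g′} → f ≈[ n ] f′ → g ≈[ n ] g′ → f *ₛ g ≈[ n ] f′ *ₛ g′
  *-cong[] f≈ g≈ {i} i<n = sum-cong-≋ {suc i} λ j → *-cong
    (f≈ (ℕ.≤-<-trans (Fin.toℕ≤pred[n] j) i<n))
    (g≈ (ℕ.≤-<-trans (ℕ.m∸n≤m i (toℕ j)) i<n))

  -- Fixed points of contractions

  module Contraction (Φ : Series → Series)
    (Φ-contracts : ∀ {n f g} → f ≈[ n ] g → Φ f ≈[ suc n ] Φ g) where

    iterate : ℕ → Series
    iterate zero    = 0ₛ
    iterate (suc n) = Φ (iterate n)

    iterate-stable : ∀ n → iterate n ≈[ n ] iterate (suc n)
    iterate-stable zero    ()
    iterate-stable (suc n) = Φ-contracts (iterate-stable n)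

    -- The diagonal limit of the iterates: coefficient `n` is stable from `iterate (suc n)` onwards.
    fixedPoint : Series
    fixedPoint n = iterate (suc n) n

    fixedPoint≈iterate : ∀ n → fixedPoint ≈[ n ] iterate n
    fixedPoint≈iterate (suc n) {i} i<1+n with ℕ.m≤n⇒m<n∨m≡n (ℕ.s≤s⁻¹ i<1+n)
    ... | inj₁ i<n    = trans (fixedPoint≈iterate n i<n) (iterate-stable n i<n)
    ... | inj₂ ≡.refl = refl

    -- The limit agrees with `iterate n` below `n`, so one application of `Φ` makes the agreement
    -- with `iterate (suc n)` reach coefficient `n` itself.
    fixedPoint-fixed : fixedPoint ≈ₛ Φ fixedPoint
    fixedPoint-fixed n = sym (Φ-contracts (fixedPoint≈iterate n) ℕ.≤-refl)

  -- Cancellation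

  *-leading : ∀ n {f} g → f ≈[ n ] 0ₛ → (f *ₛ g) n ≈ f n * g 0
  *-leading zero        g f≈0 = +-identityʳ _
  *-leading (suc n) {f} g f≈0 = begin
    f 0 * g (suc n) + (tail f *ₛ g) n
      ≈⟨ +-cong (*-congʳ (f≈0 (s≤s z≤n))) (*-leading n g (f≈0 ∘ s≤s)) ⟩
    0# * g (suc n) + f (suc n) * g 0  ≈⟨ +-congʳ (zeroˡ _) ⟩
    0# + f (suc n) * g 0              ≈⟨ +-identityˡ _ ⟩
    f (suc n) * g 0                   ∎

  -- Once the coefficients of `f` below `n` vanish, coefficient `n` of the product is `f n * g 0`,
  -- and regularity of `g 0` forces `f n` to vanish too.
  *ₛ-cancelʳ-0 : ∀ f g → (∀ a → a * g 0 ≈ 0# → a ≈ 0#) → f *ₛ g ≈ₛ 0ₛ → f ≈ₛ 0ₛ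
  *ₛ-cancelʳ-0 f g regular fg≈0 n = agree (suc n) ℕ.≤-refl
    where
    agree : ∀ n → f ≈[ n ] 0ₛ
    agree (suc n) {i} i<1+n with ℕ.m≤n⇒m<n∨m≡n (ℕ.s≤s⁻¹ i<1+n)
    ... | inj₁ i<n    = agree n i<n
    ... | inj₂ ≡.refl = regular (f n) (trans (sym (*-leading n g (agree n))) (fg≈0 n))

-- Polynomials embed into power series, from which they inherit the ring laws

module PolynomialProperties {c ℓ} (R : CommutativeRing c ℓ) where
  open CommutativeRing R
  open RingProperties ring using (-0#≈0#)
  open PowerSeriesProperties R using (_*ₛ_; *ₛ-zeroˡ; powerSeriesRing)

  coeff-addₚ : ∀ p q k → coeff rawRing (addₚ rawRing p q) k ≈ coeff rawRing p k + coeff rawRing q k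
  coeff-addₚ []      q       k       = sym (+-identityˡ _)
  coeff-addₚ (a ∷ p) []      k       = sym (+-identityʳ _)
  coeff-addₚ (a ∷ p) (b ∷ q) zero    = refl
  coeff-addₚ (a ∷ p) (b ∷ q) (suc k) = coeff-addₚ p q k

  coeff-map : ∀ φ → φ 0# ≈ 0# → ∀ p k → coeff rawRing (map φ p) k ≈ φ (coeff rawRing p k)
  coeff-map φ φ0 []      k       = sym φ0
  coeff-map φ φ0 (a ∷ p) zero    = refl
  coeff-map φ φ0 (a ∷ p) (suc k) = coeff-map φ φ0 p k

  -- Polynomial and series products both recurse on head and tail of the first factor, so the two
  -- sides unfold in step.
  coeff-mulₚ : ∀ p q k →
    coeff rawRing (mulₚ rawRing p q) k ≈ (coeff rawRing p *ₛ coeff rawRing q) k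
  coeff-mulₚ []      q k       = sym (*ₛ-zeroˡ (coeff rawRing q) k)
  coeff-mulₚ (a ∷ p) q zero    =
    trans (coeff-addₚ (map (a *_) q) _ 0) (+-congʳ (coeff-map (a *_) (zeroʳ a) q 0))
  coeff-mulₚ (a ∷ p) q (suc k) = trans (coeff-addₚ (map (a *_) q) _ (suc k))
    (+-cong (coeff-map (a *_) (zeroʳ a) q (suc k)) (coeff-mulₚ p q k))

  coeff-1 : ∀ k → coeff rawRing [ 1# ] k ≈ constant rawRing 1# k
  coeff-1 zero    = refl
  coeff-1 (suc k) = refl

  coeff-isRingMonomorphism :
    IsRingMonomorphism (Polynomial rawRing) (PowerSeries rawRing) (coeff rawRing)
  coeff-isRingMonomorphism = record
    { isRingHomomorphism = record
      { isSemiringHomomorphism = record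
        { isNearSemiringHomomorphism = record
          { +-isMonoidHomomorphism = record
            { isMagmaHomomorphism = record
              { isRelHomomorphism = record { cong = id }
              ; homo = coeff-addₚ
              }
            ; ε-homo = λ _ → refl
            }
          ; *-homo = coeff-mulₚ
          }
        ; 1#-homo = coeff-1
        }
      ; -‿homo = coeff-map -_ -0#≈0#
      }
    ; injective = id
    }

  polynomialRing : CommutativeRing c ℓ
  polynomialRing = record
    { isCommutativeRing = RingMonomorphism.isCommutativeRing coeff-isRingMonomorphism
        (CommutativeRing.isCommutativeRing powerSeriesRing)
    }

-- Finite sums

module FiniteSums {c ℓ} (R : CommutativeRing c ℓ) where
  open CommutativeRing R
  open SetoidReasoning setoid

  -- Peeling off the largest index makes `sumBelow (suc (suc a))` unfold into the three cases for a
  -- letter after `a`: smaller than `a`, equal to `a`, equal to `suc a`.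
  sumBelow : ℕ → (ℕ → Carrier) → Carrier
  sumBelow zero    g = 0#
  sumBelow (suc n) g = sumBelow n g + g n

  sumBelow-cong : ∀ k {f g} → (∀ {b} → b < k → f b ≈ g b) → sumBelow k f ≈ sumBelow k g
  sumBelow-cong zero    f≈g = refl
  sumBelow-cong (suc k) f≈g =
    +-cong (sumBelow-cong k (λ b<k → f≈g (ℕ.m<n⇒m<1+n b<k))) (f≈g ℕ.≤-refl)

  sumBelow-0 : ∀ k → sumBelow k (λ _ → 0#) ≈ 0#
  sumBelow-0 zero    = refl
  sumBelow-0 (suc k) = trans (+-identityʳ _) (sumBelow-0 k)

  *-distribˡ-sumBelow : ∀ a k f → sumBelow k (λ b → a * f b) ≈ a * sumBelow k f
  *-distribˡ-sumBelow a zero    f = sym (zeroʳ a)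
  *-distribˡ-sumBelow a (suc k) f =
    trans (+-congʳ (*-distribˡ-sumBelow a k f)) (sym (distribˡ a _ _))

  total : ∀ {a} {A : Set a} → (A → Carrier) → List A → Carrier
  total f xs = foldr _+_ 0# (map f xs)

  module _ {a} {A : Set a} where

    total-cong : ∀ {f g : A → Carrier} → (∀ x → f x ≈ g x) → ∀ xs → total f xs ≈ total g xs
    total-cong f≈g []       = refl
    total-cong f≈g (x ∷ xs) = +-cong (f≈g x) (total-cong f≈g xs)

    total-0 : ∀ (xs : List A) → total (λ _ → 0#) xs ≈ 0#
    total-0 []       = refl
    total-0 (x ∷ xs) = trans (+-identityˡ _) (total-0 xs)

    total-* : ∀ a (f : A → Carrier) xs → total (λ x → a * f x) xs ≈ a * total f xs
    total-* a f []       = sym (zeroʳ a)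
    total-* a f (x ∷ xs) = trans (+-congˡ (total-* a f xs)) (sym (distribˡ a _ _))

    total-++ : ∀ (f : A → Carrier) xs ys → total f (xs ++ ys) ≈ total f xs + total f ys
    total-++ f []       ys = sym (+-identityˡ _)
    total-++ f (x ∷ xs) ys = trans (+-congˡ (total-++ f xs ys)) (sym (+-assoc _ _ _))

    total-map : ∀ {b} {B : Set b} (f : A → Carrier) (h : B → A) xs →
                total f (map h xs) ≈ total (f ∘ h) xs
    total-map f h xs = reflexive (≡.cong (foldr _+_ 0#) (≡.sym (List.map-∘ xs)))

    total-concatMap : ∀ {b} {B : Set b} (f : A → Carrier) (h : B → List A) xs →
                      total f (concatMap h xs) ≈ total (total f ∘ h) xs
    total-concatMap f h []       = refl
    total-concatMap f h (x ∷ xs) =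
      trans (total-++ f (h x) (concatMap h xs)) (+-congˡ (total-concatMap f h xs))

    total-filter : ∀ {p} {P : Pred A p} (P? : Unary.Decidable P) (f : A → Carrier) xs →
      total f (filter P? xs) ≈ total (λ x → if does (P? x) then f x else 0#) xs
    total-filter P? f []       = refl
    total-filter P? f (x ∷ xs) with does (P? x)
    ... | true  = +-congˡ (total-filter P? f xs)
    ... | false = trans (total-filter P? f xs) (sym (+-identityˡ _))

  total-upTo : ∀ f k → total f (upTo k) ≈ sumBelow k f
  total-upTo f zero    = refl
  total-upTo f (suc k) = begin
    total f (upTo (suc k))          ≡⟨ ≡.cong (total f) (List.upTo-∷ʳ k) ⟨
    total f (upTo k ∷ʳ k)           ≈⟨ total-++ f (upTo k) [ k ] ⟩
    total f (upTo k) + (f k + 0#)   ≈⟨ +-cong (total-upTo f k) (+-identityʳ _) ⟩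
    sumBelow k f + f k              ∎

-- The identities between F, G and D hold in any commutative ring; keeping the
-- ring abstract also keeps the ring solver from unfolding power series.

module ClosedForm
  {c ℓ} (R : CommutativeRing c ℓ)
  (ι : ℤ.+-*-rawRing -Raw-AlmostCommutative⟶ fromCommutativeRing R)
  where
  open CommutativeRing R
  open _-Raw-AlmostCommutative⟶_ ι using (1-homo) renaming (⟦_⟧ to embed)
  open RawSemiringDefinitions (Semiring.rawSemiring semiring) using (_^_)
  open FiniteSums R using (sumBelow)
  open SetoidReasoning setoid

  embed-≟ : ∀ m n → Maybe (embed m ≈ embed n)
  embed-≟ m n = Maybe.map (λ { ≡.refl → refl }) (dec⇒maybe (m ℤ.≟ n))

  open RingSolver ℤ.+-*-rawRing (fromCommutativeRing R) ι
    embed-≟ renaming (Polynomial to Expr)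

  # : ℕ → Carrier
  # n = embed (+ n)

  :# : ∀ {k} → ℕ → Expr k
  :# n = con (+ n)

  -- A factor `x` is taken out of every term containing `D`; this makes the map a contraction when
  -- `x` is the indeterminate.
  quadraticStep : (x y D : Carrier) → Carrier
  quadraticStep x y D = # 1 + x * (# 2 * D + x * (x * (y * (D * D))))

  :quadraticStep : ∀ {k} (x y D : Expr k) → Expr k
  :quadraticStep x y D = :# 1 :+ x :* (:# 2 :* D :+ x :* (x :* (y :* (D :* D))))

  module _ (x y D : Carrier) where

    root : Carrier
    root = # 1 - # 2 * x - # 2 * x ^ 3 * y * D

    root² : D ≈ quadraticStep x y D →
      root * root ≈ # 1 - # 4 * x + # 4 * x ^ 2 - # 4 * x ^ 3 * y
    root² D-fixed = begin
      root * root
        -- Completing the square: this holds for every `D`, and the last factor is 1 plus the defect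
        -- of `D` in the quadratic equation.
        ≈⟨ solve 3 (λ x y D →
             let root = :# 1 :- :# 2 :* x :- :# 2 :* x :^ 3 :* y :* D in
             root :* root :=
             :# 1 :- :# 4 :* x :+ :# 4 :* x :^ 2
               :- :# 4 :* x :^ 3 :* y :* (:# 1 :+ (D :- :quadraticStep x y D)))
             refl x y D ⟩
      # 1 - # 4 * x + # 4 * x ^ 2 - # 4 * x ^ 3 * y * (# 1 + (D - quadraticStep x y D))
        ≈⟨ +-congˡ (-‿cong (*-congˡ (+-congˡ (+-congˡ (-‿cong D-fixed))))) ⟨
      # 1 - # 4 * x + # 4 * x ^ 2 - # 4 * x ^ 3 * y * (# 1 + (D - D))
        ≈⟨ solve 3 (λ x y D →
             let f = λ d → :# 1 :- :# 4 :* x :+ :# 4 :* x :^ 2 :- :# 4 :* x :^ 3 :* y :* d in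
             f (:# 1 :+ (D :- D)) := f (:# 1))
             refl x y D ⟩
      # 1 - # 4 * x + # 4 * x ^ 2 - # 4 * x ^ 3 * y * # 1
        ≈⟨ +-congˡ (-‿cong (trans (*-congˡ 1-homo) (*-identityʳ _))) ⟩
      # 1 - # 4 * x + # 4 * x ^ 2 - # 4 * x ^ 3 * y ∎

    -- Everything but the 1 is a multiple of `x`, so the constant term of the root can be read off.
    root-leading : root ≈ # 1 + x * (- (# 2 + # 2 * x ^ 2 * y * D))
    root-leading = solve 3 (λ x y D →
      :# 1 :- :# 2 :* x :- :# 2 :* x :^ 3 :* y :* D :=
      :# 1 :+ x :* (:- (:# 2 :+ :# 2 :* x :^ 2 :* y :* D)))
      refl x y D

    -- Subtracting the equations for G a and G (a + 1) gives x G (a + 2) - G (a + 1) + (1 - x + x²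
    -- y) G a = 0. If `D` solves its quadratic equation, the ratio 1 + x² y D is a root of the
    -- characteristic polynomial.
    closedForm : ℕ → Carrier
    closedForm a = (# 1 - x) * D * (# 1 + x * (x * (y * D))) ^ a

    C-closedForm : ∀ {C} → C ≈ closedForm 0 →
      # 2 * x ^ 3 * y * C ≈ (# 1 - # 2 * x - root) * (# 1 - x)
    C-closedForm {C} C≈ = begin
      # 2 * x ^ 3 * y * C
        ≈⟨ *-congˡ (trans C≈ (*-identityʳ _)) ⟩
      # 2 * x ^ 3 * y * ((# 1 - x) * D)
        ≈⟨ solve 3 (λ x y D →
             :# 2 :* x :^ 3 :* y :* ((:# 1 :- x) :* D) :=
             (:# 1 :- :# 2 :* x :- (:# 1 :- :# 2 :* x :- :# 2 :* x :^ 3 :* y :* D)) :* (:# 1 :- x))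
             refl x y D ⟩
      (# 1 - # 2 * x - root) * (# 1 - x) ∎

    -- A geometric sum: the ratio minus 1 is x² y D, so multiplying by x² y clears the denominator.
    sumBelow-closedForm : ∀ a →
      x * (x * (y * sumBelow a closedForm)) ≈
      (# 1 - x) * ((# 1 + x * (x * (y * D))) ^ a - # 1)
    sumBelow-closedForm zero = begin
      x * (x * (y * 0#))        ≈⟨ *-congˡ (*-congˡ (zeroʳ y)) ⟩
      x * (x * 0#)              ≈⟨ *-congˡ (zeroʳ x) ⟩
      x * 0#                    ≈⟨ zeroʳ x ⟩
      0#                        ≈⟨ zeroʳ _ ⟨
      (# 1 - x) * 0#            ≈⟨ *-congˡ (-‿inverseʳ (# 1)) ⟨
      (# 1 - x) * (# 1 - # 1)   ≈⟨ *-congˡ (+-congʳ 1-homo) ⟩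
      (# 1 - x) * (1# - # 1)    ∎
    sumBelow-closedForm (suc a) = begin
      x * (x * (y * (sumBelow a closedForm + closedForm a)))
        ≈⟨ solve 5 (λ x y D s p →
             x :* (x :* (y :* (s :+ (:# 1 :- x) :* D :* p))) :=
             x :* (x :* (y :* s)) :+ x :* (x :* (y :* ((:# 1 :- x) :* D :* p))))
             refl x y D (sumBelow a closedForm) ((# 1 + x * (x * (y * D))) ^ a) ⟩
      x * (x * (y * sumBelow a closedForm)) + x * (x * (y * closedForm a))
        ≈⟨ +-congʳ (sumBelow-closedForm a) ⟩
      (# 1 - x) * ((# 1 + x * (x * (y * D))) ^ a - # 1) + x * (x * (y * closedForm a))
        ≈⟨ solve 4 (λ x y D p →
             (:# 1 :- x) :* (p :- :# 1) :+ x :* (x :* (y :* ((:# 1 :- x) :* D :* p))) :=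
             (:# 1 :- x) :* ((:# 1 :+ x :* (x :* (y :* D))) :* p :- :# 1))
             refl x y D ((# 1 + x * (x * (y * D))) ^ a) ⟩
      (# 1 - x) * ((# 1 + x * (x * (y * D))) ^ suc a - # 1) ∎

    closedForm-recurrence : D ≈ quadraticStep x y D → ∀ a → closedForm a ≈
      # 1 - x + x * (closedForm a + closedForm (suc a) + x * (y * sumBelow a closedForm))
    closedForm-recurrence D-fixed a = begin
      (# 1 - x) * D * p
        ≈⟨ *-congʳ (*-congˡ D-fixed) ⟩
      (# 1 - x) * quadraticStep x y D * p
        -- The constant 1 of `quadraticStep` contributes `p`, split as 1 plus `p - 1`; the second
        -- piece becomes the sum over smaller letters.
        ≈⟨ solve 4 (λ x y D p →
             (:# 1 :- x) :* :quadraticStep x y D :* p :=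
             :# 1 :- x :+ x :* ((:# 1 :- x) :* D :* p
               :+ (:# 1 :- x) :* D :* ((:# 1 :+ x :* (x :* (y :* D))) :* p))
               :+ (:# 1 :- x) :* (p :- :# 1))
             refl x y D p ⟩
      # 1 - x + x * (closedForm a + closedForm (suc a)) + (# 1 - x) * (p - # 1)
        ≈⟨ +-congˡ (sumBelow-closedForm a) ⟨
      # 1 - x + x * (closedForm a + closedForm (suc a)) + x * (x * (y * sumBelow a closedForm))
        ≈⟨ +-assoc _ _ _ ⟩
      # 1 - x + (x * (closedForm a + closedForm (suc a)) + x * (x * (y * sumBelow a closedForm)))
        ≈⟨ +-congˡ (distribˡ _ _ _) ⟨
      # 1 - x + x * (closedForm a + closedForm (suc a) + x * (y * sumBelow a closedForm)) ∎
      where p = (# 1 + x * (x * (y * D))) ^ a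

  eliminate-F : ∀ {x y s G G′ F F′} →
    G ≈ # 1 + x * F → G′ ≈ # 1 + x * F′ → F ≈ # 1 + x * (F + F′ + y * s) →
    G ≈ # 1 - x + x * (G + G′ + x * (y * s))
  eliminate-F {x} {y} {s} {G} {G′} {F} {F′} G≈ G′≈ F≈ = begin
    G                                        ≈⟨ G≈ ⟩
    # 1 + x * F                              ≈⟨ +-congˡ (*-congˡ F≈) ⟩
    # 1 + x * (# 1 + x * (F + F′ + y * s))
      -- Completing both `x * F` and `x * F′` to the form of `G` uses two ones where only one is
      -- present; `- x` compensates.
      ≈⟨ solve 5 (λ x y s F F′ →
           :# 1 :+ x :* (:# 1 :+ x :* (F :+ F′ :+ y :* s)) :=
           :# 1 :- x :+ x :* (:# 1 :+ x :* F :+ (:# 1 :+ x :* F′) :+ x :* (y :* s)))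
           refl x y s F F′ ⟩
    # 1 - x + x * (# 1 + x * F + (# 1 + x * F′) + x * (y * s))
      ≈⟨ +-congˡ (*-congˡ (+-congʳ (+-cong G≈ G′≈))) ⟨
    # 1 - x + x * (G + G′ + x * (y * s)) ∎

  difference-of-squares : ∀ s t → (t - s) * (t + s) ≈ t * t - s * s
  difference-of-squares = solve 2 (λ s t → (t :- s) :* (t :+ s) := t :* t :- s :* s) refl

-- Descent weights of Catalan words

module Weights {c ℓ} (R : CommutativeRing c ℓ) (y : CommutativeRing.Carrier R) where
  open CommutativeRing R
  open RawSemiringDefinitions (Semiring.rawSemiring semiring) using (_^_)
  open FiniteSums R
  open SetoidReasoning setoid

  -- Forbidden words get weight zero rather than being filtered out, so sums over all continuations
  -- can be split by the next letter.
  weight : Word → Carrier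
  weight w = if does (avoids? _>?_ _≢?_ w) then y ^ des w else 0#

  avoids-∷ : ∀ {a b u} → ¬ a > b → Avoids _>_ _≢_ (a ∷ b ∷ u) ⇔ Avoids _>_ _≢_ (b ∷ u)
  avoids-∷ a≯b = mk⇔ (λ avoids → avoids ∘ there)
    λ { avoids (here a>b _) → a≯b a>b ; avoids (there r) → avoids r }

  avoids-descent : ∀ {a b u} → Avoids _>_ _≢_ (a ∷ b ∷ b ∷ u) ⇔ Avoids _>_ _≢_ (b ∷ b ∷ u)
  avoids-descent = mk⇔ (λ avoids → avoids ∘ there)
    λ { avoids (here _ b≢b) → b≢b ≡.refl ; avoids (there r) → avoids r }

  des-∷ : ∀ {a b} u → ¬ a > b → des (a ∷ b ∷ u) ≡ des (b ∷ u)
  des-∷ {a} {b} u a≯b rewrite dec-false (a >? b) a≯b = ≡.refl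

  des-descent : ∀ {a b} u → a > b → des (a ∷ b ∷ u) ≡ suc (des (b ∷ u))
  des-descent {a} {b} u a>b rewrite dec-true (a >? b) a>b = ≡.refl

  weight-∷ : ∀ {a b} u → ¬ a > b → weight (a ∷ b ∷ u) ≡ weight (b ∷ u)
  weight-∷ {a} {b} u a≯b = ≡.cong₂ (λ t d → if t then y ^ d else 0#)
    (does-⇔ (avoids-∷ a≯b) (avoids? _>?_ _≢?_ (a ∷ b ∷ u)) (avoids? _>?_ _≢?_ (b ∷ u)))
    (des-∷ u a≯b)

  weight-descent-end : ∀ {a b} → a > b → weight (a ∷ b ∷ []) ≈ y * 1#
  weight-descent-end a>b = reflexive (≡.cong (y ^_) (des-descent [] a>b))

  if-y^suc : ∀ t d → (if t then y ^ suc d else 0#) ≈ y * (if t then y ^ d else 0#)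
  if-y^suc true  d = refl
  if-y^suc false d = sym (zeroʳ y)

  -- The descent contributes `y` and cannot start a pattern, because the step after it is level; the
  -- repeated `b` then changes neither avoidance nor descents.
  weight-descent-≡ : ∀ {a b} u → a > b → weight (a ∷ b ∷ b ∷ u) ≈ y * weight (b ∷ u)
  weight-descent-≡ {a} {b} u a>b = begin
    weight (a ∷ b ∷ b ∷ u)
      ≡⟨ ≡.cong₂ (λ t d → if t then y ^ d else 0#)
           (does-⇔ avoids-descent (avoids? _>?_ _≢?_ (a ∷ b ∷ b ∷ u)) (avoids? _>?_ _≢?_ (b ∷ b ∷ u)))
           (des-descent (b ∷ u) a>b) ⟩
    (if does (avoids? _>?_ _≢?_ (b ∷ b ∷ u)) then y ^ suc (des (b ∷ b ∷ u)) else 0#)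
      ≈⟨ if-y^suc (does (avoids? _>?_ _≢?_ (b ∷ b ∷ u))) (des (b ∷ b ∷ u)) ⟩
    y * weight (b ∷ b ∷ u)
      ≡⟨ ≡.cong (y *_) (weight-∷ u (ℕ.<-irrefl ≡.refl)) ⟩
    y * weight (b ∷ u) ∎

  weight-descent-≢ : ∀ {a b c} u → a > b → b ≢ c → weight (a ∷ b ∷ c ∷ u) ≈ 0#
  weight-descent-≢ {a} {b} {c} u a>b b≢c = reflexive (≡.cong
    (λ t → if t then y ^ des (a ∷ b ∷ c ∷ u) else 0#)
    (dec-false (avoids? _>?_ _≢?_ (a ∷ b ∷ c ∷ u)) (λ avoids → avoids (here a>b b≢c))))

  -- The index `n` counts only the letters after `a`, but the weight also sees the step out of `a`.
  F : ℕ → ℕ → Carrier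
  F a n = total (λ u → weight (a ∷ u)) (continuations a n)

  -- After a descent to a, the next letter must be a again.
  G : ℕ → ℕ → Carrier
  G a zero    = 1#
  G a (suc n) = F a n

  total-continuations : ∀ (f : Word → Carrier) a n → total f (continuations a (suc n)) ≈
    sumBelow (suc (suc a)) (λ b → total (λ u → f (b ∷ u)) (continuations b n))
  total-continuations f a n = begin
    total f (continuations a (suc n))
      ≈⟨ total-concatMap f (λ b → map (b ∷_) (continuations b n)) (upTo (suc (suc a))) ⟩
    total (λ b → total f (map (b ∷_) (continuations b n))) (upTo (suc (suc a)))
      ≈⟨ total-upTo _ (suc (suc a)) ⟩
    sumBelow (suc (suc a)) (λ b → total f (map (b ∷_) (continuations b n)))
      ≈⟨ sumBelow-cong (suc (suc a)) (λ {b} _ → total-map f (b ∷_) (continuations b n)) ⟩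
    sumBelow (suc (suc a)) (λ b → total (λ u → f (b ∷ u)) (continuations b n)) ∎

  total-descent : ∀ {a b} n → a > b → total (λ u → weight (a ∷ b ∷ u)) (continuations b n) ≈ y * G b n
  total-descent {a} {b} zero    a>b = trans (+-identityʳ _) (weight-descent-end a>b)
  total-descent {a} {b} (suc n) a>b = begin
    total (λ u → weight (a ∷ b ∷ u)) (continuations b (suc n))
      ≈⟨ total-continuations (λ u → weight (a ∷ b ∷ u)) b n ⟩
    sumBelow b after + after b + after (suc b)
      -- A third letter other than `b` completes the pattern, so only the middle term survives.
      ≈⟨ +-cong (+-cong
           (trans (sumBelow-cong b (λ c<b → after-≢ (ℕ.>⇒≢ c<b))) (sumBelow-0 b))
           (trans (total-cong (λ u → weight-descent-≡ u a>b) (continuations b n))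
                  (total-* y (λ u → weight (b ∷ u)) (continuations b n))))
           (after-≢ (ℕ.<⇒≢ (ℕ.n<1+n b))) ⟩
    0# + y * F b n + 0#
      ≈⟨ trans (+-identityʳ _) (+-identityˡ _) ⟩
    y * F b n ∎
    where
    after : ℕ → Carrier
    after c = total (λ u → weight (a ∷ b ∷ c ∷ u)) (continuations c n)

    after-≢ : ∀ {c} → b ≢ c → after c ≈ 0#
    after-≢ {c} b≢c = trans
      (total-cong (λ u → weight-descent-≢ u a>b b≢c) (continuations c n))
      (total-0 (continuations c n))

  F-zero : ∀ a → F a 0 ≈ 1#
  F-zero a = +-identityʳ _

  -- A next letter below `a` makes a descent and contributes through `G`; the letters `a` and
  -- `suc a` make none and simply restart the count.
  F-suc : ∀ a n → F a (suc n) ≈ F a n + F (suc a) n + y * sumBelow a (λ b → G b n)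
  F-suc a n = begin
    F a (suc n)
      ≈⟨ total-continuations (λ u → weight (a ∷ u)) a n ⟩
    sumBelow a after + after a + after (suc a)
      ≈⟨ +-cong (+-cong
           (trans (sumBelow-cong a (total-descent n)) (*-distribˡ-sumBelow y a (λ b → G b n)))
           (total-cong (λ u → reflexive (weight-∷ u (ℕ.<-irrefl ≡.refl))) (continuations a n)))
           (total-cong (λ u → reflexive (weight-∷ u (ℕ.<-asym (ℕ.n<1+n a)))) (continuations (suc a) n)) ⟩
    y * sumBelow a (λ b → G b n) + F a n + F (suc a) n
      ≈⟨ +-assoc _ _ _ ⟩
    y * sumBelow a (λ b → G b n) + (F a n + F (suc a) n)
      ≈⟨ +-comm _ _ ⟩
    F a n + F (suc a) n + y * sumBelow a (λ b → G b n) ∎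
    where
    after : ℕ → Carrier
    after b = total (λ u → weight (a ∷ b ∷ u)) (continuations b n)

  generatingFunction : ℕ → Carrier
  generatingFunction n =
    foldr _+_ 0# (map (λ w → y ^ des w) (filter (avoids? _>?_ _≢?_) (catalanWords n)))

  generatingFunction-weight : ∀ n → generatingFunction n ≈ total weight (catalanWords n)
  generatingFunction-weight n = total-filter (avoids? _>?_ _≢?_) (λ w → y ^ des w) (catalanWords n)

  -- A nonempty Catalan word has its first letter 0 prescribed, exactly as a nonempty word counted
  -- by `G 0` does; that letter accounts for the index shift in `G`.
  generatingFunction≈G : ∀ n → generatingFunction n ≈ G 0 n
  generatingFunction≈G zero    = trans (generatingFunction-weight 0) (+-identityʳ _)
  generatingFunction≈G (suc n) =
    trans (generatingFunction-weight (suc n)) (total-map weight (0 ∷_) (continuations 0 n))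

-- The system of equations as power series

module GeneratingFunction {c ℓ} (R : CommutativeRing c ℓ)
  (κ : ℤ.+-*-rawRing -Raw-AlmostCommutative⟶ fromCommutativeRing R)
  where
  open CommutativeRing R
  open _-Raw-AlmostCommutative⟶_ κ renaming (⟦_⟧ to embed)
  open FiniteSums R using (sumBelow)
  open PowerSeriesProperties R hiding (_≈ₛ_; _+ₛ_; _*ₛ_; -ₛ_)
  open FiniteSums powerSeriesRing using () renaming (sumBelow to sumBelowₛ)
  module S = CommutativeRing powerSeriesRing
  open S using () renaming (_≈_ to _≈ₛ_; _+_ to _+ₛ_; _*_ to _*ₛ_; _-_ to _-ₛ_; -_ to -ₛ_)

  constant-embed :
    ℤ.+-*-rawRing -Raw-AlmostCommutative⟶ fromCommutativeRing powerSeriesRing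
  constant-embed = record
    { ⟦_⟧    = λ m → constant rawRing (embed m)
    ; +-homo = λ { m n zero → +-homo m n ; m n (suc k) → sym (+-identityʳ _) }
    ; *-homo = λ
      { m n zero    → trans (*-homo m n) (sym (+-identityʳ _))
      ; m n (suc k) → sym (trans (constant-*ₛ (embed m) (constant rawRing (embed n)) (suc k)) (zeroʳ _))
      }
    ; -‿homo = λ { m zero → -‿homo m ; m (suc k) → sym (RingProperties.-0#≈0# ring) }
    ; 0-homo = λ { zero → 0-homo ; (suc k) → refl }
    ; 1-homo = λ { zero → 1-homo ; (suc k) → refl }
    }

  open ClosedForm powerSeriesRing constant-embed
  open RawSemiringDefinitions (Semiring.rawSemiring S.semiring) using (_^_)

  -- In (t - s)(t + s) = 0 the second factor has constant term 2, which is regular by hypothesis, so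
  -- it can be cancelled.
  sqrt-unique : (∀ a → a + a ≈ 0# → a ≈ 0#) →
    ∀ {s t} → s 0 ≈ 1# → t 0 ≈ 1# → t *ₛ t ≈ₛ s *ₛ s → t ≈ₛ s
  sqrt-unique +-regular {s} {t} s₀ t₀ t²≈s² = x∙y⁻¹≈ε⇒x≈y t s
    (*ₛ-cancelʳ-0 (t -ₛ s) (t +ₛ s) regular
      (λ n → trans (difference-of-squares s t n)
        (trans (+-congʳ (t²≈s² n)) (-‿inverseʳ _))))
    where
    open RingProperties S.ring using (x∙y⁻¹≈ε⇒x≈y)

    regular : ∀ a → a * (t 0 + s 0) ≈ 0# → a ≈ 0#
    regular a a*2≈0 = +-regular a (trans (sym (trans
      (*-congˡ (+-cong t₀ s₀))
      (trans (distribˡ a 1# 1#) (+-cong (*-identityʳ a) (*-identityʳ a))))) a*2≈0)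

  -- Solving the system in power series

  module CatalanSeries (y : Carrier) (x : Series)
    (x-zero : x 0 ≈ 0#) (x-suc : ∀ n → x (suc n) ≈ 1ₛ n) where
    open Weights R y using (F; G; F-zero; F-suc; generatingFunction; generatingFunction≈G)

    yₛ : Series
    yₛ = constant rawRing y

    x-*-zero : ∀ f → (x *ₛ f) 0 ≈ 0#
    x-*-zero f = trans (+-identityʳ _) (trans (*-congʳ x-zero) (zeroˡ _))

    x-*-suc : ∀ f n → (x *ₛ f) (suc n) ≈ f n
    x-*-suc f n = trans
      (+-cong (trans (*-congʳ x-zero) (zeroˡ _))
              (trans (*ₛ-cong {tail x} {1ₛ} {f} {f} x-suc (λ _ → refl) n) (*ₛ-identityˡ f n)))
      (+-identityˡ _)

    ≈1+x* : ∀ {f g} → f 0 ≈ 1# → (∀ n → f (suc n) ≈ g n) → f ≈ₛ # 1 +ₛ x *ₛ g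
    ≈1+x* {f} {g} f₀ f₁ zero    =
      trans f₀ (sym (trans (+-cong 1-homo (x-*-zero g)) (+-identityʳ _)))
    ≈1+x* {f} {g} f₀ f₁ (suc n) = trans (f₁ n) (sym (trans (+-identityˡ _) (x-*-suc g n)))

    -- Multiplication by the indeterminate gains one degree of agreement; both the existence of `D`
    -- and the uniqueness of solutions rest on this.
    x-*-cong[] : ∀ {n f g} → f ≈[ n ] g → x *ₛ f ≈[ suc n ] x *ₛ g
    x-*-cong[] {f = f} {g} f≈g {zero}  _         = trans (x-*-zero f) (sym (x-*-zero g))
    x-*-cong[] {f = f} {g} f≈g {suc i} (s≤s i<n) =
      trans (x-*-suc f i) (trans (f≈g i<n) (sym (x-*-suc g i)))

    *-congˡ[] : ∀ {n} h {f g} → f ≈[ n ] g → h *ₛ f ≈[ n ] h *ₛ g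
    *-congˡ[] h {f} {g} = *-cong[] {f = h} {h} {f} {g} (λ _ → refl)

    quadraticStep-contracts : ∀ {n f g} → f ≈[ n ] g →
      quadraticStep x yₛ f ≈[ suc n ] quadraticStep x yₛ g
    quadraticStep-contracts {n} {f} {g} f≈g i<1+n = +-congˡ (x-*-cong[]
      {f = # 2 *ₛ f +ₛ x *ₛ (x *ₛ (yₛ *ₛ (f *ₛ f)))}
      {g = # 2 *ₛ g +ₛ x *ₛ (x *ₛ (yₛ *ₛ (g *ₛ g)))}
      (λ i<n → +-cong
        (*-congˡ[] (# 2) {f} {g} f≈g i<n)
        (*-congˡ[] x {x *ₛ (yₛ *ₛ (f *ₛ f))} {x *ₛ (yₛ *ₛ (g *ₛ g))}
          (*-congˡ[] x {yₛ *ₛ (f *ₛ f)} {yₛ *ₛ (g *ₛ g)}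
            (*-congˡ[] yₛ {f *ₛ f} {g *ₛ g} (*-cong[] {f = f} {g} {f} {g} f≈g f≈g))) i<n))
      i<1+n)

    open Contraction (quadraticStep x yₛ) quadraticStep-contracts

    -- Unfolding the iteration would make comparisons of series built from it explode.
    opaque
      D : Series
      D = fixedPoint

      D-fixed : D ≈ₛ quadraticStep x yₛ D
      D-fixed = fixedPoint-fixed

    sumBelowₛ-coeff : ∀ a (g : ℕ → Series) n → sumBelowₛ a g n ≈ sumBelow a (λ b → g b n)
    sumBelowₛ-coeff zero    g n = refl
    sumBelowₛ-coeff (suc a) g n = +-congʳ (sumBelowₛ-coeff a g n)

    sumBelowₛ-cong[] : ∀ {n} a {f g : ℕ → Series} → (∀ b → f b ≈[ n ] g b) →
      sumBelowₛ a f ≈[ n ] sumBelowₛ a g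
    sumBelowₛ-cong[] zero    f≈g i<n = refl
    sumBelowₛ-cong[] (suc a) f≈g i<n = +-cong (sumBelowₛ-cong[] a f≈g i<n) (f≈g a i<n)

    F-equation : ∀ a → F a ≈ₛ # 1 +ₛ x *ₛ (F a +ₛ F (suc a) +ₛ yₛ *ₛ sumBelowₛ a G)
    F-equation a = ≈1+x* (F-zero a) λ n → trans (F-suc a n) (+-congˡ (sym
      (trans (constant-*ₛ y (sumBelowₛ a G) n) (*-congˡ (sumBelowₛ-coeff a G n)))))

    G-equation : ∀ a → G a ≈ₛ # 1 +ₛ x *ₛ F a
    G-equation a = ≈1+x* refl (λ _ → refl)

    G-recurrence : ∀ a →
      G a ≈ₛ (# 1 -ₛ x) +ₛ x *ₛ (G a +ₛ G (suc a) +ₛ x *ₛ (yₛ *ₛ sumBelowₛ a G))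
    G-recurrence a = eliminate-F {x} {yₛ} {sumBelowₛ a G} {G a} {G (suc a)} {F a} {F (suc a)}
      (G-equation a) (G-equation (suc a)) (F-equation a)

    -- All unknowns stand behind a factor `x`, so agreement below `n` extends to `suc n`. The
    -- induction treats all `a` together, since the equation at `a` involves `suc a`.
    recurrence-unique : ∀ {U V : ℕ → Series} →
      (∀ a → U a ≈ₛ (# 1 -ₛ x) +ₛ x *ₛ (U a +ₛ U (suc a) +ₛ x *ₛ (yₛ *ₛ sumBelowₛ a U))) →
      (∀ a → V a ≈ₛ (# 1 -ₛ x) +ₛ x *ₛ (V a +ₛ V (suc a) +ₛ x *ₛ (yₛ *ₛ sumBelowₛ a V))) →
      ∀ a → U a ≈ₛ V a
    recurrence-unique {U} {V} U-rec V-rec a n = agree (suc n) a ℕ.≤-refl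
      where
      agree : ∀ n a → U a ≈[ n ] V a
      agree zero    a ()
      agree (suc n) a {i} i<1+n = trans (U-rec a i) (trans (+-congˡ
        (x-*-cong[] {f = U a +ₛ U (suc a) +ₛ x *ₛ (yₛ *ₛ sumBelowₛ a U)}
                    {g = V a +ₛ V (suc a) +ₛ x *ₛ (yₛ *ₛ sumBelowₛ a V)}
          (λ j<n → +-cong (+-cong (agree n a j<n) (agree n (suc a) j<n))
            (*-congˡ[] x {yₛ *ₛ sumBelowₛ a U} {yₛ *ₛ sumBelowₛ a V}
              (*-congˡ[] yₛ {sumBelowₛ a U} {sumBelowₛ a V}
                (sumBelowₛ-cong[] a (agree n))) j<n))
          i<1+n))
        (sym (V-rec a i)))

    generatingFunction≈closedForm : generatingFunction ≈ₛ closedForm x yₛ D 0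
    generatingFunction≈closedForm n = trans (generatingFunction≈G n)
      (recurrence-unique {G} {closedForm x yₛ D}
        G-recurrence (closedForm-recurrence x yₛ D D-fixed) 0 n)

    √radicand : Series
    √radicand = root x yₛ D

    √radicand₀ : √radicand 0 ≈ 1#
    √radicand₀ = trans (root-leading x yₛ D 0)
      (trans (+-cong 1-homo (x-*-zero (-ₛ (# 2 +ₛ # 2 *ₛ x ^ 2 *ₛ yₛ *ₛ D)))) (+-identityʳ _))

    √radicand² : √radicand *ₛ √radicand ≈ₛ
      # 1 -ₛ # 4 *ₛ x +ₛ # 4 *ₛ x ^ 2 -ₛ # 4 *ₛ x ^ 3 *ₛ yₛ
    √radicand² = root² x yₛ D D-fixed

    C-formula : # 2 *ₛ x ^ 3 *ₛ yₛ *ₛ generatingFunction ≈ₛ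
                (# 1 -ₛ # 2 *ₛ x -ₛ √radicand) *ₛ (# 1 -ₛ x)
    C-formula = C-closedForm x yₛ D {generatingFunction} generatingFunction≈closedForm

-- Specialisation to integer polynomials in y

ℤ[y]-ring : CommutativeRing _ _
ℤ[y]-ring = PolynomialProperties.polynomialRing ℤ.+-*-commutativeRing

ℤ⟶ℤ[y] : ℤ.+-*-rawRing -Raw-AlmostCommutative⟶ fromCommutativeRing ℤ[y]-ring
ℤ⟶ℤ[y] = record
  { ⟦_⟧    = [_]
  ; +-homo = λ { m n zero → ≡.refl ; m n (suc k) → ≡.refl }
  ; *-homo = λ { m n zero → ≡.sym (ℤ.+-identityʳ (m ℤ.* n)) ; m n (suc k) → ≡.refl }
  ; -‿homo = λ { m zero → ≡.refl ; m (suc k) → ≡.refl }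
  ; 0-homo = λ { zero → ≡.refl ; (suc k) → ≡.refl }
  ; 1-homo = λ { zero → ≡.refl ; (suc k) → ≡.refl }
  }

ℤ-+-regular : ∀ i → i ℤ.+ i ≡ + 0 → i ≡ + 0
ℤ-+-regular (+ zero)  _  = ≡.refl
ℤ-+-regular (+ suc n) ()
ℤ-+-regular (ℤ.-[1+ n ]) ()

open ℤ[y]⟦x⟧

-- Absence of 2-torsion, inherited coefficientwise from the integers, is what makes the square root
-- unique.
+-regular : ∀ p → p ℤ[y].+ p ℤ[y].≈ ℤ[y].0# → p ℤ[y].≈ ℤ[y].0#
+-regular p p+p≈0 k = ℤ-+-regular _
  (≡.trans (≡.sym (PolynomialProperties.coeff-addₚ ℤ.+-*-commutativeRing p p k)) (p+p≈0 k))

x-suc : ∀ n → x (suc n) ℤ[y].≈ constant ℤ[y] ℤ[y].1# n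
x-suc zero    _ = ≡.refl
x-suc (suc n) _ = ≡.refl

theorem3p32 : ∃ λ S →
    IsTheSqrt (1# - # 4 * x + # 4 * x ^ 2 - # 4 * x ^ 3 * y) S ×
    # 2 * x ^ 3 * y * C _>?_ _≢?_ ≈ (1# - # 2 * x - S) * (1# - x)
theorem3p32 = √radicand
  , ((√radicand₀ , √radicand²)
    , λ t (t₀ , t²) → sqrt-unique +-regular {√radicand} {t} √radicand₀ t₀
        (λ n k → ≡.trans (t² n k) (≡.sym (√radicand² n k))))
  , C-formula
  where
  open GeneratingFunction ℤ[y]-ring ℤ⟶ℤ[y] using (sqrt-unique; module CatalanSeries)
  open CatalanSeries ℤ[y].y x (λ _ → ≡.refl) x-suc using (√radicand; √radicand₀; √radicand²; C-formula)
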